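{- Let $m\ge 2$ be an integer and let $a_0\ge a_1\ge\cdots\ge a_{m-1}>0$ be real numbers. For every $r\in\{1,\dots,m\}$ and every circular arrangement $z=(z_0,\dots,z_{m-1})$ of $(a_0,\dots,a_{m-1})$, $$P_r(a^G)\ge P_r(z),$$ where $a^G$ is the greedy arrangement of $(a_0,\dots,a_{m-1})$.
   Context: A circular arrangement $z=(z_0,\dots,z_{m-1})$ of $(a_0,\dots,a_{m-1})$ is a permutation of these numbers (as a multiset), with indices of $z$ read modulo $m$. For such $z$ and $r\in\{1,\dots,m\}$, $$P_r(z)=\sum_{k=0}^{m-1}\prod_{j=0}^{r-1}z_{k+j},$$ with indices modulo $m$. The greedy (circular-symmetric) arrangement $a^G=(a^G_0,\dots,a^G_{m-1})$ is defined by $a^G_i=a_{2i}$ and $a^G_{m-1-i}=a_{2i+1}$ for $i=0,\dots,\lfloor m/2\rfloor-1$, together with $a^G_{\lfloor m/2\rfloor}=a_{m-1}$ when $m$ is odd. -}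

module Defs where

open import Level using (_⊔_) renaming (suc to lsuc)
open import Algebra.Apartness.Bundles using (HeytingField; HeytingCommutativeRing)
open import Algebra.Bundles using (CommutativeRing)
import Algebra.Definitions.RawMonoid as RawMonoidOps
open import Data.Bool.Base using (if_then_else_)
open import Data.Fin.Base using (Fin; toℕ)
open import Data.Fin.Permutation using (Permutation′; _⟨$⟩ʳ_)
open import Data.Fin.Properties using (toℕ<n; toℕ-injective; toℕ-fromℕ<)
open import Data.Nat.Base as ℕ using (ℕ; zero; suc; NonZero; ⌊_/2⌋; ⌈_/2⌉)
import Data.Nat.Properties as ℕ
open import Data.Nat.DivMod using (_mod_; m%n<n; m<n⇒m%n≡m)
open import Data.Product.Base using (∃; _×_; _,_; proj₁; proj₂)
open import Data.Sum.Base using (_⊎_)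
open import Function.Bundles using (_⇔_)
open import Relation.Binary.Core using (Rel)
open import Relation.Binary.Structures using (IsStrictPartialOrder)
open import Relation.Nullary.Decidable using (does; dec-true; dec-false)
open import Relation.Nullary.Negation.Core using (¬_)
open import Relation.Binary.PropositionalEquality
  using (_≡_; refl; sym; trans; cong; subst; module ≡-Reasoning)

-- The standard library has no real numbers, so they are taken to be an
-- arbitrary Cauchy complete Archimedean ordered field; classically any such
-- field is isomorphic to ℝ.  The order is not assumed decidable or total, so
-- that the axioms also hold for the constructive Cauchy and Dedekind reals.
-- Cotransitivity of _<_ and 0# < 1# follow from the axioms for _#_.
record RealNumbers c ℓ₁ ℓ₂ : Set (lsuc (c ⊔ ℓ₁ ⊔ ℓ₂)) where
  field
    heytingField : HeytingField c ℓ₁ ℓ₂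

  open HeytingField heytingField public

  commutativeRing : CommutativeRing c ℓ₁
  commutativeRing = HeytingCommutativeRing.commutativeRing heytingCommutativeRing

  open CommutativeRing commutativeRing public
    using (+-rawMonoid; *-rawMonoid)
  open RawMonoidOps +-rawMonoid public
    using (sum) renaming (_×_ to _·_)
  open RawMonoidOps *-rawMonoid public
    using () renaming (sum to product)

  infix 4 _<_ _≤_

  field
    _<_                  : Rel Carrier ℓ₂
    isStrictPartialOrder : IsStrictPartialOrder _≈_ _<_
    #⇔<⊎>                : ∀ x y → (x # y) ⇔ (x < y ⊎ y < x)
    +-monoˡ-<            : ∀ {x y} z → x < y → (x + z) < (y + z)
    *-pos                : ∀ {x y} → 0# < x → 0# < y → 0# < (x * y)
    archimedean          : ∀ x → ∃ λ n → x < n · 1#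

  -- For real numbers x ≤ y is the negation of y < x, also constructively.
  _≤_ : Rel Carrier ℓ₂
  x ≤ y = ¬ (y < x)

  -- |u i - u j| < ε is written without absolute values: i and j range over
  -- the same indices, so the one-sided bound suffices.
  IsCauchy : (ℕ → Carrier) → Set (c ⊔ ℓ₂)
  IsCauchy u = ∀ ε → 0# < ε →
    ∃ λ N → ∀ i j → N ℕ.≤ i → N ℕ.≤ j → u i < (u j + ε)

  _ConvergesTo_ : (ℕ → Carrier) → Carrier → Set (c ⊔ ℓ₂)
  u ConvergesTo x = ∀ ε → 0# < ε →
    ∃ λ N → ∀ i → N ℕ.≤ i → (u i < (x + ε)) × (x < (u i + ε))

  field
    complete : ∀ u → IsCauchy u → ∃ λ x → u ConvergesTo x

module _ {c ℓ₁ ℓ₂} (ℝ : RealNumbers c ℓ₁ ℓ₂) where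
  open RealNumbers ℝ using (Carrier; _≈_; sum; product)

  -- z lists the same multiset of numbers as a.
  IsArrangement : ∀ {m} → (a z : Fin m → Carrier) → Set ℓ₁
  IsArrangement {m} a z =
    ∃ λ (σ : Permutation′ m) → ∀ i → z i ≈ a (σ ⟨$⟩ʳ i)

  P : ∀ {m} .{{_ : NonZero m}} → ℕ → (Fin m → Carrier) → Carrier
  P {m} r z = sum {m} λ k → product {r} λ j → z ((toℕ k ℕ.+ toℕ j) mod m)

-- The index of the entry of a placed at position k.  For odd m the middle
-- position k = ⌊m/2⌋ is below ⌈m/2⌉ and receives index 2k = m - 1.
greedyIndex : ℕ → ℕ → ℕ
greedyIndex m k =
  if does (k ℕ.<? ⌈ m /2⌉)
  then 2 ℕ.* k
  else 2 ℕ.* (m ℕ.∸ 1 ℕ.∸ k) ℕ.+ 1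

-- The reduction modulo m only serves to produce an element of Fin m: the
-- lemmas below, which are the defining equations of the greedy arrangement,
-- show that the index never wraps around.
greedy : ∀ {a} {A : Set a} {m} .{{_ : NonZero m}} → (Fin m → A) → (Fin m → A)
greedy {m = m} a k = a (greedyIndex m (toℕ k) mod m)

private
  greedyIndex-< : ∀ m k → k ℕ.< ⌈ m /2⌉ → greedyIndex m k ≡ 2 ℕ.* k
  greedyIndex-< m k k<h =
    cong (if_then 2 ℕ.* k else (2 ℕ.* (m ℕ.∸ 1 ℕ.∸ k) ℕ.+ 1)) (dec-true (k ℕ.<? ⌈ m /2⌉) k<h)

  greedyIndex-≮ : ∀ m k → ¬ (k ℕ.< ⌈ m /2⌉) →
                  greedyIndex m k ≡ 2 ℕ.* (m ℕ.∸ 1 ℕ.∸ k) ℕ.+ 1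
  greedyIndex-≮ m k k≮h =
    cong (if_then 2 ℕ.* k else (2 ℕ.* (m ℕ.∸ 1 ℕ.∸ k) ℕ.+ 1)) (dec-false (k ℕ.<? ⌈ m /2⌉) k≮h)

  mod-≡ : ∀ {m n} .{{_ : NonZero m}} (q : Fin m) → n ≡ toℕ q → n mod m ≡ q
  mod-≡ {m} {n} q refl = toℕ-injective
    (trans (toℕ-fromℕ< (m%n<n n m)) (m<n⇒m%n≡m (toℕ<n q)))

  reflected≮ : ∀ m i → i ℕ.< ⌊ m /2⌋ → ¬ (m ℕ.∸ 1 ℕ.∸ i ℕ.< ⌈ m /2⌉)
  reflected≮ m i i<h = ℕ.≤⇒≯ (subst (⌈ m /2⌉ ℕ.≤_) (sym (ℕ.∸-+-assoc m 1 i))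
    (ℕ.≤-trans (ℕ.≤-reflexive (sym m∸h)) (ℕ.∸-monoʳ-≤ m i<h)))
    where
    m∸h : m ℕ.∸ ⌊ m /2⌋ ≡ ⌈ m /2⌉
    m∸h = trans (cong (ℕ._∸ ⌊ m /2⌋) (sym (ℕ.⌊n/2⌋+⌈n/2⌉≡n m)))
                (ℕ.m+n∸m≡n ⌊ m /2⌋ ⌈ m /2⌉)

  i≤m∸1 : ∀ m i → i ℕ.< ⌊ m /2⌋ → i ℕ.≤ m ℕ.∸ 1
  i≤m∸1 m i i<h = ℕ.∸-monoˡ-≤ 1 (ℕ.≤-trans i<h (ℕ.⌊n/2⌋≤n m))

  ⌊⌋,⌈⌉-odd : ∀ n → ⌊ 2 ℕ.* n ℕ.+ 1 /2⌋ ≡ n × ⌈ 2 ℕ.* n ℕ.+ 1 /2⌉ ≡ suc n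
  ⌊⌋,⌈⌉-odd n = subst (λ k → ⌊ k /2⌋ ≡ n × ⌈ k /2⌉ ≡ suc n) (sym eq) (floor n , ceil n)
    where
    eq : 2 ℕ.* n ℕ.+ 1 ≡ suc (n ℕ.+ n)
    eq = trans (ℕ.+-comm (2 ℕ.* n) 1)
               (cong (λ k → suc (n ℕ.+ k)) (ℕ.+-identityʳ n))
    ceil : ∀ n → ⌈ suc (n ℕ.+ n) /2⌉ ≡ suc n
    ceil n = cong suc (sym (ℕ.n≡⌊n+n/2⌋ n))
    floor : ∀ n → ⌊ suc (n ℕ.+ n) /2⌋ ≡ n
    floor zero    = refl
    floor (suc n) = trans (cong (λ k → suc ⌊ k /2⌋) (ℕ.+-suc n n)) (cong suc (floor n))

module _ {ℓ} {A : Set ℓ} {m} .{{_ : NonZero m}} (a : Fin m → A) (p q : Fin m) where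

  greedy-front : ∀ i → i ℕ.< ⌊ m /2⌋ →
                 toℕ p ≡ i → toℕ q ≡ 2 ℕ.* i → greedy a p ≡ a q
  greedy-front i i<h refl q≡ = cong a (mod-≡ q
    (trans (greedyIndex-< m i (ℕ.≤-trans i<h (ℕ.⌊n/2⌋≤⌈n/2⌉ m))) (sym q≡)))

  greedy-back : ∀ i → i ℕ.< ⌊ m /2⌋ →
                toℕ p ≡ m ℕ.∸ 1 ℕ.∸ i → toℕ q ≡ 2 ℕ.* i ℕ.+ 1 → greedy a p ≡ a q
  greedy-back i i<h p≡ q≡ = cong a (mod-≡ q (begin
    greedyIndex m (toℕ p)                            ≡⟨ cong (greedyIndex m) p≡ ⟩
    greedyIndex m (m ℕ.∸ 1 ℕ.∸ i)                    ≡⟨ greedyIndex-≮ m _ (reflected≮ m i i<h) ⟩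
    2 ℕ.* (m ℕ.∸ 1 ℕ.∸ (m ℕ.∸ 1 ℕ.∸ i)) ℕ.+ 1        ≡⟨ cong (λ k → 2 ℕ.* k ℕ.+ 1) (ℕ.m∸[m∸n]≡n (i≤m∸1 m i i<h)) ⟩
    2 ℕ.* i ℕ.+ 1                                    ≡⟨ sym q≡ ⟩
    toℕ q                                            ∎))
    where open ≡-Reasoning

  greedy-middle : ∀ n → m ≡ 2 ℕ.* n ℕ.+ 1 →
                  toℕ p ≡ ⌊ m /2⌋ → toℕ q ≡ m ℕ.∸ 1 → greedy a p ≡ a q
  greedy-middle n refl p≡ q≡ = cong a (mod-≡ q (begin
    greedyIndex m (toℕ p)    ≡⟨ cong (greedyIndex m) (trans p≡ (proj₁ (⌊⌋,⌈⌉-odd n))) ⟩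
    greedyIndex m n          ≡⟨ greedyIndex-< m n (ℕ.≤-reflexive (sym (proj₂ (⌊⌋,⌈⌉-odd n)))) ⟩
    2 ℕ.* n                  ≡⟨ sym (ℕ.m+n∸n≡m (2 ℕ.* n) 1) ⟩
    m ℕ.∸ 1                  ≡⟨ sym q≡ ⟩
    toℕ q                    ∎))
    where
    open ≡-Reasoning

{-# OPTIONS --safe #-}

-- Polarization.  For a reflection ρ of ℤ/m, whenever a pair of positions
-- {p, ρ p} carries the larger number farther from the centre -1/4 of the
-- greedy arrangement, exchange the two numbers.  Adding the contributions of
-- an arc and of its mirror image, pairs lying inside the arc contribute a
-- common factor, and the remaining positions lie on one side of the axis; so
-- after the exchange one of the two products collects all the larger factors
-- and the sum does not decrease.  If the n largest numbers are already at
-- their greedy places, the reflection that exchanges the place and the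
-- current position of the next number keeps them there and moves that number
-- to its place, so m polarizations lead to the greedy arrangement.
module Submission where

open import Defs
import Algebra.Properties.CommutativeMonoid.Sum
open import Algebra.Bundles using (CommutativeRing)
open import Data.Bool.Base using (if_then_else_)
open import Data.Empty using (⊥)
open import Data.Nat.Base as ℕ using (ℕ; zero; suc; NonZero; ⌊_/2⌋; ⌈_/2⌉; s≤s)
import Data.Nat.Properties as ℕ
open import Data.Nat.DivMod
  using (_mod_; _%_; m%n<n; m<n⇒m%n≡m; m%n%n≡m%n; %-distribˡ-+; [m+n]%n≡m%n; [m+kn]%n≡m%n)
open import Data.Fin.Base as Fin using (Fin; zero; suc; toℕ; fromℕ<; opposite; punchOut)
open import Data.Fin.Permutation using (Permutation′; permutation; reverse)
open import Data.Fin.Properties as Fin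
  using (toℕ<n; toℕ-injective; toℕ-fromℕ<; any?; opposite-prop; punchOut-injective; injective⇒≤)
open import Data.Product.Base using (∃; _×_; _,_; proj₁; proj₂)
open import Data.Sum.Base as Sum using (_⊎_; inj₁; inj₂; [_,_]′)
open import Function.Base using (_∘_)
open import Function.Bundles using (Equivalence; Injection)
open import Function.Definitions using (Injective)
open import Function.Properties.Inverse using (↔⇒↣)
open import Relation.Binary.Bundles using (Preorder)
open import Relation.Binary.Definitions using (tri<; tri≈; tri>)
open import Relation.Binary.PropositionalEquality
  using (_≡_; _≢_; refl; sym; trans; cong; cong₂; subst; subst₂; module ≡-Reasoning)
open import Relation.Binary.Structures using (IsStrictPartialOrder)
open import Relation.Nullary using (¬_; Dec; yes; no; contradiction)
open import Relation.Nullary.Decidable using (dec-true; dec-false; map′; _×-dec_; _⊎-dec_; ¬?; toSum)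

-- If `y` were missed, punching it out of the codomain would inject `suc n` points into `n`.
injective⇒surjective : ∀ {n} (f : Fin n → Fin n) → Injective _≡_ _≡_ f → ∀ y → ∃ λ x → f x ≡ y
injective⇒surjective {suc n} f f-inj y with any? (λ x → f x Fin.≟ y)
... | yes x↦y = x↦y
... | no ∄x = contradiction (injective⇒≤ {f = λ x → punchOut (y≢f x)} punch-inj) (ℕ.<-irrefl refl)
  where
  y≢f : ∀ x → y ≢ f x
  y≢f x y≡fx = ∄x (x , sym y≡fx)
  punch-inj : Injective _≡_ _≡_ (λ x → punchOut (y≢f x))
  punch-inj {x} {x′} eq = f-inj (punchOut-injective (y≢f x) (y≢f x′) eq)

-- Arithmetic of the greedy order on positions.

module _ {m : ℕ} where

  private
    complement : ∀ {k} → k ℕ.< m → ∃ λ e → k ℕ.+ suc e ≡ m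
    complement {k} k<m = m ℕ.∸ suc k ,
      trans (ℕ.+-suc k _) (ℕ.m+[n∸m]≡n k<m)

  -- Doubling `k` replaces halving `m`, so that later comparisons are linear in the positions.
  greedyIndex-front : ∀ {k} → k ℕ.+ k ℕ.< m → greedyIndex m k ≡ k ℕ.+ k
  greedyIndex-front {k} 2k<m = begin
    greedyIndex m k                ≡⟨ cong (if_then 2 ℕ.* k else (2 ℕ.* (m ℕ.∸ 1 ℕ.∸ k) ℕ.+ 1))
                                           (dec-true (k ℕ.<? ⌈ m /2⌉) k<h) ⟩
    2 ℕ.* k                        ≡⟨ cong (k ℕ.+_) (ℕ.+-identityʳ k) ⟩
    k ℕ.+ k                        ∎
    where
    open ≡-Reasoning
    k<h : k ℕ.< ⌈ m /2⌉
    k<h = ℕ.≰⇒> λ h≤k → ℕ.<-irrefl refl (ℕ.<-≤-trans 2k<m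
      (subst (ℕ._≤ k ℕ.+ k) (ℕ.⌊n/2⌋+⌈n/2⌉≡n m)
        (ℕ.+-mono-≤ (ℕ.≤-trans (ℕ.⌊n/2⌋≤⌈n/2⌉ m) h≤k) h≤k)))

  greedyIndex-back : ∀ {k e} → k ℕ.+ suc e ≡ m → m ℕ.≤ k ℕ.+ k → greedyIndex m k ≡ suc (e ℕ.+ e)
  greedyIndex-back {k} {e} k+1+e≡m m≤2k = begin
    greedyIndex m k                ≡⟨ cong (if_then 2 ℕ.* k else (2 ℕ.* (m ℕ.∸ 1 ℕ.∸ k) ℕ.+ 1))
                                           (dec-false (k ℕ.<? ⌈ m /2⌉) k≮h) ⟩
    2 ℕ.* (m ℕ.∸ 1 ℕ.∸ k) ℕ.+ 1    ≡⟨ cong (λ x → 2 ℕ.* x ℕ.+ 1) m∸1∸k≡e ⟩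
    2 ℕ.* e ℕ.+ 1                  ≡⟨ ℕ.+-comm _ 1 ⟩
    suc (2 ℕ.* e)                  ≡⟨ cong (λ x → suc (e ℕ.+ x)) (ℕ.+-identityʳ e) ⟩
    suc (e ℕ.+ e)                  ∎
    where
    open ≡-Reasoning
    m∸1∸k≡e : m ℕ.∸ 1 ℕ.∸ k ≡ e
    m∸1∸k≡e = trans (cong (λ x → x ℕ.∸ 1 ℕ.∸ k) (trans (sym k+1+e≡m) (ℕ.+-suc k e))) (ℕ.m+n∸m≡n k e)
    ⌈⌉≤1+⌊⌋ : ∀ n → ⌈ n /2⌉ ℕ.≤ suc ⌊ n /2⌋
    ⌈⌉≤1+⌊⌋ zero = ℕ.z≤n
    ⌈⌉≤1+⌊⌋ (suc zero) = ℕ.≤-refl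
    ⌈⌉≤1+⌊⌋ (suc (suc n)) = s≤s (⌈⌉≤1+⌊⌋ n)
    k≮h : ¬ k ℕ.< ⌈ m /2⌉
    k≮h k<h = ℕ.<-irrefl refl (ℕ.<-≤-trans
      (ℕ.+-mono-≤-< (ℕ.≤-pred (ℕ.≤-trans k<h (⌈⌉≤1+⌊⌋ m))) k<h)
      (subst (ℕ._≤ k ℕ.+ k) (sym (ℕ.⌊n/2⌋+⌈n/2⌉≡n m)) m≤2k))

  greedyIndex<m : ∀ {k} → k ℕ.< m → greedyIndex m k ℕ.< m
  greedyIndex<m {k} k<m with ℕ.<-≤-connex (k ℕ.+ k) m
  ... | inj₁ 2k<m = subst (ℕ._< m) (sym (greedyIndex-front 2k<m)) 2k<m
  ... | inj₂ m≤2k with complement k<m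
  ...   | e , refl = subst (ℕ._< m) (sym (greedyIndex-back refl m≤2k))
    (subst (ℕ._≤ k ℕ.+ suc e) (cong suc (ℕ.+-suc e e))
      (ℕ.+-monoˡ-≤ (suc e) (ℕ.+-cancelˡ-≤ k (suc e) k m≤2k)))

  -- Positions are ordered by their distance on the circle from -1/4, a point
  -- that no reflection of ℤ/m fixes.
  infix 4 _◁_
  record _◁_ (x y : ℕ) : Set where
    constructor ◁-by
    field greedyIndex-< : greedyIndex m x ℕ.< greedyIndex m y

  open _◁_ public

  _◁?_ : ∀ x y → Dec (x ◁ y)
  x ◁? y = map′ ◁-by greedyIndex-< (greedyIndex m x ℕ.<? greedyIndex m y)

  ◁-asym : ∀ {x y} → x ◁ y → ¬ y ◁ x
  ◁-asym (◁-by x<y) (◁-by y<x) = ℕ.<-asym x<y y<x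

  -- Since `x + x < x + y < m`, the index of `x` is `2x`. That of `y` is `2y`, or `2e + 1` with
  -- `e = m - 1 - y`, where `x + y < m` gives `x ≤ e`.
  ◁-front : ∀ {x y} → y ℕ.< m → x ℕ.+ y ℕ.< m → x ℕ.< y → x ◁ y
  ◁-front {x} {y} y<m x+y<m x<y with ℕ.<-≤-connex (y ℕ.+ y) m
  ... | inj₁ 2y<m = ◁-by (subst₂ ℕ._<_ (sym x-front) (sym (greedyIndex-front 2y<m)) (ℕ.+-mono-< x<y x<y))
    where
    x-front : greedyIndex m x ≡ x ℕ.+ x
    x-front = greedyIndex-front (ℕ.<-trans (ℕ.+-monoʳ-< x x<y) x+y<m)
  ... | inj₂ m≤2y with complement y<m
  ...   | e , y+1+e≡m = ◁-by (subst₂ ℕ._<_ (sym x-front) (sym (greedyIndex-back y+1+e≡m m≤2y))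
    (s≤s (ℕ.+-mono-≤ x≤e x≤e)))
    where
    x-front : greedyIndex m x ≡ x ℕ.+ x
    x-front = greedyIndex-front (ℕ.<-trans (ℕ.+-monoʳ-< x x<y) x+y<m)
    x≤e : x ℕ.≤ e
    x≤e = ℕ.≤-pred (ℕ.+-cancelˡ-< y x (suc e)
      (subst₂ ℕ._<_ (ℕ.+-comm x y) (sym y+1+e≡m) x+y<m))

  -- Here `x` lies in the back half and has index `2e + 1` with `e = m - 1 - x`. For `y` in the
  -- front half `m ≤ x + y` gives `e < y`; for `y` in the back half `y < x` gives `e < f`.
  ◁-back : ∀ {x y} → x ℕ.< m → m ℕ.≤ x ℕ.+ y → y ℕ.< x → x ◁ y
  ◁-back {x} {y} x<m m≤x+y y<x with complement x<m
  ... | e , x+1+e≡m with ℕ.<-≤-connex (y ℕ.+ y) m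
  ...   | inj₁ 2y<m = ◁-by (subst₂ ℕ._<_ (sym x-back) (sym (greedyIndex-front 2y<m))
    (subst (ℕ._≤ y ℕ.+ y) (cong suc (ℕ.+-suc e e)) (ℕ.+-mono-≤ 1+e≤y 1+e≤y)))
    where
    x-back : greedyIndex m x ≡ suc (e ℕ.+ e)
    x-back = greedyIndex-back x+1+e≡m (ℕ.≤-trans m≤x+y (ℕ.+-monoʳ-≤ x (ℕ.<⇒≤ y<x)))
    1+e≤y : suc e ℕ.≤ y
    1+e≤y = ℕ.+-cancelˡ-≤ x (suc e) y (subst (ℕ._≤ x ℕ.+ y) (sym x+1+e≡m) m≤x+y)
  ...   | inj₂ m≤2y with complement (ℕ.<-trans y<x x<m)
  ...     | f , y+1+f≡m = ◁-by (subst₂ ℕ._<_ (sym x-back) (sym (greedyIndex-back y+1+f≡m m≤2y))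
    (s≤s (ℕ.+-mono-< e<f e<f)))
    where
    x-back : greedyIndex m x ≡ suc (e ℕ.+ e)
    x-back = greedyIndex-back x+1+e≡m (ℕ.≤-trans m≤x+y (ℕ.+-monoʳ-≤ x (ℕ.<⇒≤ y<x)))
    e<f : e ℕ.< f
    e<f = ℕ.≰⇒> λ f≤e → ℕ.<-irrefl (trans y+1+f≡m (sym x+1+e≡m)) (ℕ.+-mono-<-≤ y<x (s≤s f≤e))

  -- On {0, …, m-1} this is _◁_ without the case distinction of greedyIndex.
  Nearer : ℕ → ℕ → Set
  Nearer x y = (x ℕ.+ y ℕ.< m × x ℕ.< y) ⊎ (m ℕ.≤ x ℕ.+ y × y ℕ.< x)

  nearer-total : ∀ {x y} → x ≢ y → Nearer x y ⊎ Nearer y x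
  nearer-total {x} {y} x≢y with ℕ.<-≤-connex (x ℕ.+ y) m | ℕ.<-cmp x y
  ... | _          | tri≈ _ x≡y _ = contradiction x≡y x≢y
  ... | inj₁ x+y<m | tri< x<y _ _ = inj₁ (inj₁ (x+y<m , x<y))
  ... | inj₁ x+y<m | tri> _ _ y<x = inj₂ (inj₁ (subst (ℕ._< m) (ℕ.+-comm x y) x+y<m , y<x))
  ... | inj₂ m≤x+y | tri< x<y _ _ = inj₂ (inj₂ (subst (m ℕ.≤_) (ℕ.+-comm x y) m≤x+y , x<y))
  ... | inj₂ m≤x+y | tri> _ _ y<x = inj₁ (inj₂ (m≤x+y , y<x))

  nearer⇒◁ : ∀ {x y} → x ℕ.< m → y ℕ.< m → Nearer x y → x ◁ y
  nearer⇒◁ x<m y<m (inj₁ (x+y<m , x<y)) = ◁-front y<m x+y<m x<y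
  nearer⇒◁ x<m y<m (inj₂ (m≤x+y , y<x)) = ◁-back x<m m≤x+y y<x

  ◁⇒nearer : ∀ {x y} → x ℕ.< m → y ℕ.< m → x ◁ y → Nearer x y
  ◁⇒nearer {x} {y} x<m y<m x◁y
    with nearer-total {x} {y} (λ x≡y → ℕ.<⇒≢ (greedyIndex-< x◁y) (cong (greedyIndex m) x≡y))
  ... | inj₁ near = near
  ... | inj₂ far  = contradiction (nearer⇒◁ y<m x<m far) (◁-asym x◁y)

  greedyIndex-injective : ∀ {x y} → x ℕ.< m → y ℕ.< m → greedyIndex m x ≡ greedyIndex m y → x ≡ y
  greedyIndex-injective {x} {y} x<m y<m eq with x ℕ.≟ y
  ... | yes x≡y = x≡y
  ... | no  x≢y with nearer-total x≢y
  ...   | inj₁ near = contradiction eq (ℕ.<⇒≢ (greedyIndex-< (nearer⇒◁ x<m y<m near)))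
  ...   | inj₂ far  = contradiction (sym eq) (ℕ.<⇒≢ (greedyIndex-< (nearer⇒◁ y<m x<m far)))

  -- Intervals and arcs cut by a reflection.

  private
    Inside Outside : ℕ → ℕ → ℕ → Set
    Inside  lo hi x = lo ℕ.≤ x × x ℕ.< hi
    Outside lo hi x = x ℕ.< lo ⊎ hi ℕ.≤ x

    exitsRight : ∀ {lo hi x y} → Inside lo hi x → Outside lo hi y → x ℕ.< y → hi ℕ.≤ y
    exitsRight (lo≤x , _) (inj₁ y<lo) x<y = contradiction (ℕ.<-≤-trans y<lo lo≤x) (ℕ.<-asym x<y)
    exitsRight _          (inj₂ hi≤y) _   = hi≤y

    exitsLeft : ∀ {lo hi x y} → Inside lo hi x → Outside lo hi y → y ℕ.< x → y ℕ.< lo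
    exitsLeft _          (inj₁ y<lo) _   = y<lo
    exitsLeft (_ , x<hi) (inj₂ hi≤y) y<x = contradiction (ℕ.<-≤-trans x<hi hi≤y) (ℕ.<-asym y<x)

  -- The congruence x + y ≡ s modulo m, for x, y and s in {0, …, m-1}.
  Mirrored : ℕ → ℕ → ℕ → Set
  Mirrored s x y = x ℕ.+ y ≡ s ⊎ x ℕ.+ y ≡ s ℕ.+ m

  mirrored-sym : ∀ {s} x y → Mirrored s x y → Mirrored s y x
  mirrored-sym x y = Sum.map (trans (ℕ.+-comm y x)) (trans (ℕ.+-comm y x))

  -- Whether the sum is `s` or `s + m` is decided by comparing it with `m`, as in `Nearer`, so the
  -- mixed cases are impossible.
  mirrored-nearer : ∀ {s x y} → s ℕ.< m → Mirrored s x y → Nearer x y →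
                    (x ℕ.+ y ≡ s × x ℕ.< y) ⊎ (x ℕ.+ y ≡ s ℕ.+ m × y ℕ.< x)
  mirrored-nearer s<m (inj₁ eq) (inj₁ (_ , x<y))     = inj₁ (eq , x<y)
  mirrored-nearer s<m (inj₁ eq) (inj₂ (m≤x+y , _))   =
    contradiction (subst (m ℕ.≤_) eq m≤x+y) (ℕ.<⇒≱ s<m)
  mirrored-nearer {s} s<m (inj₂ eq) (inj₁ (x+y<m , _)) =
    contradiction (subst (ℕ._< m) eq x+y<m) (ℕ.≤⇒≯ (ℕ.m≤n+m m s))
  mirrored-nearer s<m (inj₂ eq) (inj₂ (_ , y<x))     = inj₂ (eq , y<x)

  -- Each mirror image lies beyond a known end of the interval. If both pairs have the same sum, the
  -- ends force one sum to be strictly smaller. If the sums are `s` and `s + m`, the pair with the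
  -- larger sum has one member at most `s` and the other below `m`, which is too little.
  interval-one-sided : ∀ lo hi {s p p′ q q′} → s ℕ.< m → p ℕ.< m → q′ ℕ.< m →
    Mirrored s p p′ → Mirrored s q′ q → Nearer p p′ → Nearer q′ q →
    Inside lo hi p → Outside lo hi p′ → Inside lo hi q → Outside lo hi q′ → ⊥
  interval-one-sided lo hi {s} s<m p<m q′<m pp′ q′q near far p∈ p′∉ q∈ q′∉
    with mirrored-nearer s<m pp′ near | mirrored-nearer s<m q′q far
  ... | inj₁ (p+p′≡ , p<p′) | inj₁ (q′+q≡ , q′<q) = ℕ.<-irrefl (trans q′+q≡ (sym p+p′≡))
    (ℕ.+-mono-< (ℕ.<-≤-trans (exitsLeft q∈ q′∉ q′<q) (proj₁ p∈))
                (ℕ.<-≤-trans (proj₂ q∈) (exitsRight p∈ p′∉ p<p′)))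
  ... | inj₁ (p+p′≡ , p<p′) | inj₂ (q′+q≡ , q<q′) = ℕ.<-irrefl (trans q′+q≡ (ℕ.+-comm s m))
    (ℕ.+-mono-<-≤ q′<m (ℕ.≤-trans (ℕ.<⇒≤ (proj₂ q∈))
      (ℕ.≤-trans (exitsRight p∈ p′∉ p<p′) (subst (_ ℕ.≤_) p+p′≡ (ℕ.m≤n+m _ _)))))
  ... | inj₂ (p+p′≡ , p′<p) | inj₁ (q′+q≡ , q′<q) = ℕ.<-irrefl (trans p+p′≡ (ℕ.+-comm s m))
    (ℕ.+-mono-<-≤ p<m (ℕ.≤-trans (ℕ.<⇒≤ (exitsLeft p∈ p′∉ p′<p))
      (ℕ.≤-trans (proj₁ q∈) (subst (_ ℕ.≤_) q′+q≡ (ℕ.m≤n+m _ _)))))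
  ... | inj₂ (p+p′≡ , p′<p) | inj₂ (q′+q≡ , q<q′) = ℕ.<-irrefl (trans p+p′≡ (sym q′+q≡))
    (ℕ.+-mono-< (ℕ.<-≤-trans (proj₂ p∈) (exitsRight q∈ q′∉ q<q′))
                (ℕ.<-≤-trans (exitsLeft p∈ p′∉ p′<p) (proj₁ q∈)))

  -- A position on the arc is written k + i with i < r, one off the arc k + t
  -- with r ≤ t < m.  An arc that wraps around is the complement of an
  -- interval, which exchanges the roles of p, p′ with those of q′, q.
  arc-one-sided : ∀ {k r s p p′ q q′ i j t u} → k ℕ.< m → r ℕ.≤ m → s ℕ.< m →
    p ℕ.< m → p′ ℕ.< m → q ℕ.< m → q′ ℕ.< m →
    i ℕ.< r → Mirrored p k i → j ℕ.< r → Mirrored q k j →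
    r ℕ.≤ t → t ℕ.< m → Mirrored p′ k t → r ℕ.≤ u → u ℕ.< m → Mirrored q′ k u →
    Mirrored s p p′ → Mirrored s q q′ → p ◁ p′ → q′ ◁ q → ⊥
  arc-one-sided {k} {r} {s} {p} {p′} {q} {q′} k<m r≤m s<m p<m p′<m q<m q′<m
    i<r p≡ j<r q≡ r≤t t<m p′≡ r≤u u<m q′≡ pp′ qq′ p◁p′ q′◁q
    with ℕ.≤-<-connex (k ℕ.+ r) m
  ... | inj₁ k+r≤m = interval-one-sided k (k ℕ.+ r) s<m p<m q′<m pp′ (mirrored-sym q q′ qq′)
    (◁⇒nearer p<m p′<m p◁p′) (◁⇒nearer q′<m q<m q′◁q)
    (inside i<r p≡) (outside r≤t t<m p′≡) (inside j<r q≡) (outside r≤u u<m q′≡)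
    where
    inside : ∀ {x i} → i ℕ.< r → Mirrored x k i → Inside k (k ℕ.+ r) x
    inside {x} {i} i<r (inj₁ refl) = ℕ.m≤m+n k i , ℕ.+-monoʳ-< k i<r
    inside {x} {i} i<r (inj₂ eq) =
      contradiction (ℕ.<-≤-trans (subst (ℕ._< k ℕ.+ r) eq (ℕ.+-monoʳ-< k i<r)) k+r≤m)
        (ℕ.≤⇒≯ (ℕ.m≤n+m m x))
    outside : ∀ {x t} → r ℕ.≤ t → t ℕ.< m → Mirrored x k t → Outside k (k ℕ.+ r) x
    outside r≤t t<m (inj₁ refl) = inj₂ (ℕ.+-monoʳ-≤ k r≤t)
    outside {x} {t} r≤t t<m (inj₂ eq) =
      inj₁ (ℕ.+-cancelʳ-< m x k (subst (ℕ._< k ℕ.+ m) eq (ℕ.+-monoʳ-< k t<m)))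
  ... | inj₂ m<k+r with ℕ.m≤n⇒∃[o]m+o≡n (ℕ.<⇒≤ m<k+r)
  -- Here `l = k + r - m` is where the wrapped arc stops; its complement consists of the `x` with
  -- `l ≤ x < k`.
  ...   | l , m+l≡k+r = interval-one-sided l k s<m q′<m p<m (mirrored-sym q q′ qq′) pp′
    (◁⇒nearer q′<m q<m q′◁q) (◁⇒nearer p<m p′<m p◁p′)
    (inside q′<m r≤u u<m q′≡) (outside j<r q≡) (inside p′<m r≤t t<m p′≡) (outside i<r p≡)
    where
    l+m≡k+r : l ℕ.+ m ≡ k ℕ.+ r
    l+m≡k+r = trans (ℕ.+-comm l m) m+l≡k+r
    inside : ∀ {x t} → x ℕ.< m → r ℕ.≤ t → t ℕ.< m → Mirrored x k t → Inside l k x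
    inside x<m r≤t t<m (inj₁ refl) =
      contradiction (ℕ.<-≤-trans m<k+r (ℕ.+-monoʳ-≤ k r≤t)) (ℕ.<-asym x<m)
    inside {x} {t} _ r≤t t<m (inj₂ eq) =
      ℕ.+-cancelʳ-≤ m l x (subst₂ ℕ._≤_ (sym l+m≡k+r) eq (ℕ.+-monoʳ-≤ k r≤t)) ,
      ℕ.+-cancelʳ-< m x k (subst (ℕ._< k ℕ.+ m) eq (ℕ.+-monoʳ-< k t<m))
    outside : ∀ {x i} → i ℕ.< r → Mirrored x k i → Outside l k x
    outside {x} {i} i<r (inj₁ refl) = inj₂ (ℕ.m≤m+n k i)
    outside {x} {i} i<r (inj₂ eq) =
      inj₁ (ℕ.+-cancelʳ-< m x l (subst₂ ℕ._<_ eq (sym l+m≡k+r) (ℕ.+-monoʳ-< k i<r)))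

-- Inequalities in an ordered field whose order is not decidable.

module OrderedField {c ℓ₁ ℓ₂} (ℝ : RealNumbers c ℓ₁ ℓ₂) where
  open RealNumbers ℝ hiding (zero; refl; sym; trans)
  private module R = RealNumbers ℝ
  open CommutativeRing commutativeRing using (ring; +-commutativeMonoid; *-commutativeMonoid)
  open import Algebra.Properties.Ring ring using (-1*x≈-x; -‿involutive)
  open IsStrictPartialOrder isStrictPartialOrder using (<-respʳ-≈; <-respˡ-≈)
    renaming (irrefl to <-irrefl; trans to <-trans)
  module Σ = Algebra.Properties.CommutativeMonoid.Sum +-commutativeMonoid
  module Π = Algebra.Properties.CommutativeMonoid.Sum *-commutativeMonoid

  -- Apartness is cotransitive; where it comes out in the wrong direction, transitivity with `x < y`
  -- yields the other alternative.
  <-cotrans : ∀ {x y} → x < y → ∀ z → x < z ⊎ z < y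
  <-cotrans {x} {y} x<y z with #-cotrans (Equivalence.from (#⇔<⊎> x y) (inj₁ x<y)) z
  ... | inj₁ x#z = Sum.map₂ (λ z<x → <-trans z<x x<y) (Equivalence.to (#⇔<⊎> x z) x#z)
  ... | inj₂ z#y = Sum.swap (Sum.map₂ (<-trans x<y) (Equivalence.to (#⇔<⊎> z y) z#y))

  ≈⇒≤ : ∀ {x y} → x ≈ y → x ≤ y
  ≈⇒≤ x≈y = <-irrefl (R.sym x≈y)

  -- A strict `z < x` splits at `y` by cotransitivity, and either half is refuted.
  ≤-trans : ∀ {x y z} → x ≤ y → y ≤ z → x ≤ z
  ≤-trans {y = y} x≤y y≤z z<x = Sum.[ y≤z , x≤y ] (<-cotrans z<x y)

  ≤-preorder : Preorder c ℓ₁ ℓ₂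
  ≤-preorder = record
    { _≲_ = _≤_
    ; isPreorder = record
      { isEquivalence = isEquivalence ; reflexive = ≈⇒≤ ; trans = ≤-trans }
    }

  open import Relation.Binary.Reasoning.Preorder ≤-preorder

  x+y-y≈x : ∀ x y → (x + y) - y ≈ x
  x+y-y≈x x y = R.trans (+-assoc x y (- y)) (R.trans (+-congˡ (-‿inverseʳ y)) (+-identityʳ x))

  x-y+y≈x : ∀ x y → (x - y) + y ≈ x
  x-y+y≈x x y = R.trans (+-assoc x (- y) y) (R.trans (+-congˡ (-‿inverseˡ y)) (+-identityʳ x))

  +-monoˡ-≤ : ∀ {x y} z → x ≤ y → x + z ≤ y + z
  +-monoˡ-≤ {x} {y} z x≤y y+z<x+z =
    x≤y (<-respʳ-≈ (x+y-y≈x x z) (<-respˡ-≈ (x+y-y≈x y z) (+-monoˡ-< (- z) y+z<x+z)))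

  +-mono-≤ : ∀ {x y u v} → x ≤ y → u ≤ v → x + u ≤ y + v
  +-mono-≤ {x} {y} {u} {v} x≤y u≤v = begin
    x + u  ≲⟨ +-monoˡ-≤ u x≤y ⟩
    y + u  ≈⟨ +-comm y u ⟩
    u + y  ≲⟨ +-monoˡ-≤ y u≤v ⟩
    v + y  ≈⟨ +-comm v y ⟩
    y + v  ∎

  x+x≤y+y⇒x≤y : ∀ {x y} → x + x ≤ y + y → x ≤ y
  x+x≤y+y⇒x≤y {x} {y} 2x≤2y y<x =
    2x≤2y (<-trans (+-monoˡ-< y y<x) (<-respˡ-≈ (+-comm y x) (+-monoˡ-< x y<x)))

  0≤y-x : ∀ {x y} → x ≤ y → 0# ≤ y - x
  0≤y-x {x} {y} x≤y = begin
    0#     ≈⟨ -‿inverseʳ x ⟨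
    x - x  ≲⟨ +-monoˡ-≤ (- x) x≤y ⟩
    y - x  ∎

  -- By tightness, factors of a product apart from 0# can be taken apart from
  -- 0# when the goal is a negation.
  *-nonNeg : ∀ {x y} → 0# ≤ x → 0# ≤ y → 0# ≤ x * y
  *-nonNeg {x} {y} 0≤x 0≤y xy<0 = <-irrefl (x≈0⇒xy≈0 (proj₁ (tight x 0#) ¬x#0)) xy<0
    where
    x≈0⇒xy≈0 : x ≈ 0# → x * y ≈ 0#
    x≈0⇒xy≈0 x≈0 = R.trans (*-congʳ x≈0) (zeroˡ y)
    y≈0⇒xy≈0 : y ≈ 0# → x * y ≈ 0#
    y≈0⇒xy≈0 y≈0 = R.trans (*-congˡ y≈0) (zeroʳ x)
    positive : ∀ {z} → 0# ≤ z → z # 0# → 0# < z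
    positive {z} 0≤z z#0 with Equivalence.to (#⇔<⊎> z 0#) z#0
    ... | inj₁ z<0 = contradiction z<0 0≤z
    ... | inj₂ 0<z = 0<z
    ¬x#0 : ¬ (x # 0#)
    ¬x#0 x#0 = <-irrefl (y≈0⇒xy≈0 (proj₁ (tight y 0#) ¬y#0)) xy<0
      where
      ¬y#0 : ¬ (y # 0#)
      ¬y#0 y#0 = <-irrefl R.refl (<-trans xy<0 (*-pos (positive 0≤x x#0) (positive 0≤y y#0)))

  -- If `1#` were negative, `- 1#` would be positive and so would its square, which is `1#`.
  0≤1 : 0# ≤ 1#
  0≤1 1<0 = <-irrefl R.refl (<-trans 1<0 (<-respʳ-≈ [-1]²≈1 (*-pos 0<-1 0<-1)))
    where
    0<-1 : 0# < - 1#
    0<-1 = <-respʳ-≈ (+-identityˡ _) (<-respˡ-≈ (-‿inverseʳ 1#) (+-monoˡ-< (- 1#) 1<0))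
    [-1]²≈1 : - 1# * - 1# ≈ 1#
    [-1]²≈1 = R.trans (-1*x≈-x (- 1#)) (-‿involutive 1#)

  *-monoʳ-≤ : ∀ {x y z} → 0# ≤ z → x ≤ y → z * x ≤ z * y
  *-monoʳ-≤ {x} {y} {z} 0≤z x≤y = begin
    z * x                ≈⟨ +-identityˡ (z * x) ⟨
    0# + z * x           ≲⟨ +-monoˡ-≤ (z * x) (*-nonNeg 0≤z (0≤y-x x≤y)) ⟩
    z * (y - x) + z * x  ≈⟨ distribˡ z (y - x) x ⟨
    z * ((y - x) + x)    ≈⟨ *-congˡ (x-y+y≈x y x) ⟩
    z * y                ∎

  *-mono-≤ : ∀ {x y u v} → 0# ≤ x → 0# ≤ v → x ≤ y → u ≤ v → x * u ≤ y * v
  *-mono-≤ {x} {y} {u} {v} 0≤x 0≤v x≤y u≤v = begin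
    x * u  ≲⟨ *-monoʳ-≤ 0≤x u≤v ⟩
    x * v  ≈⟨ *-comm x v ⟩
    v * x  ≲⟨ *-monoʳ-≤ 0≤v x≤y ⟩
    v * y  ≈⟨ *-comm v y ⟩
    y * v  ∎

  sum-mono-≤ : ∀ {n} {f g : Fin n → Carrier} → (∀ i → f i ≤ g i) → sum f ≤ sum g
  sum-mono-≤ {zero}  f≤g = ≈⇒≤ R.refl
  sum-mono-≤ {suc n} f≤g = +-mono-≤ (f≤g zero) (sum-mono-≤ (λ i → f≤g (suc i)))

  -- A relation rather than max and min: the order cannot be decided, so the comparison is supplied
  -- with the pair and later comes from comparing indices.
  data Sorts (x y : Carrier) : Carrier → Carrier → Set ℓ₂ where
    keep : y ≤ x → Sorts x y x y
    swap : x ≤ y → Sorts x y y x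

  private
    -- Both sides are rewritten as `(x - y) * U + y * (U + V)`, whose coefficients are nonnegative.
    abel : ∀ {x y X X′ Y Y′} → 0# ≤ y → y ≤ x → X ≤ X′ → X + Y ≤ X′ + Y′ →
           x * X + y * Y ≤ x * X′ + y * Y′
    abel {x} {y} {X} {X′} {Y} {Y′} 0≤y y≤x X≤X′ X+Y≤X′+Y′ = begin
      x * X + y * Y                  ≈⟨ summation X Y ⟨
      (x - y) * X + y * (X + Y)      ≲⟨ +-mono-≤ (*-monoʳ-≤ (0≤y-x y≤x) X≤X′) (*-monoʳ-≤ 0≤y X+Y≤X′+Y′) ⟩
      (x - y) * X′ + y * (X′ + Y′)   ≈⟨ summation X′ Y′ ⟩
      x * X′ + y * Y′                ∎
      where
      summation : ∀ U V → (x - y) * U + y * (U + V) ≈ x * U + y * V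
      summation U V = begin-equality
        (x - y) * U + y * (U + V)        ≈⟨ +-congˡ (distribˡ y U V) ⟩
        (x - y) * U + (y * U + y * V)    ≈⟨ +-assoc _ _ _ ⟨
        ((x - y) * U + y * U) + y * V    ≈⟨ +-congʳ (distribʳ U (x - y) y) ⟨
        ((x - y) + y) * U + y * V        ≈⟨ +-congʳ (*-congʳ (x-y+y≈x x y)) ⟩
        x * U + y * V                    ∎

  -- The first three bounds keep the induction going: the sum of the products
  -- grows by Abel summation once the larger product is known to dominate both.
  sorted-products : ∀ {n} {x y x′ y′ : Fin n → Carrier} →
    (∀ i → 0# ≤ x i) → (∀ i → 0# ≤ y i) → (∀ i → Sorts (x i) (y i) (x′ i) (y′ i)) →
    0# ≤ product x′ × product x ≤ product x′ × product y ≤ product x′ ×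
    product x + product y ≤ product x′ + product y′
  sorted-products {zero} _ _ _ = 0≤1 , ≈⇒≤ R.refl , ≈⇒≤ R.refl , ≈⇒≤ R.refl
  sorted-products {suc n} {x} {y} {x′} {y′} 0≤x 0≤y sorts
    with x′ zero | y′ zero | sorts zero
       | sorted-products (λ i → 0≤x (suc i)) (λ i → 0≤y (suc i)) (λ i → sorts (suc i))
  ... | _ | _ | keep y≤x | 0≤X′ , X≤X′ , Y≤X′ , X+Y≤ =
    *-nonNeg (0≤x zero) 0≤X′ ,
    *-monoʳ-≤ (0≤x zero) X≤X′ ,
    *-mono-≤ (0≤y zero) 0≤X′ y≤x Y≤X′ ,
    abel (0≤y zero) y≤x X≤X′ X+Y≤
  ... | _ | _ | swap x≤y | 0≤X′ , X≤X′ , Y≤X′ , X+Y≤ =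
    *-nonNeg (0≤y zero) 0≤X′ ,
    *-mono-≤ (0≤x zero) 0≤X′ x≤y X≤X′ ,
    *-monoʳ-≤ (0≤y zero) Y≤X′ ,
    -- After a swap `y zero` is the larger head and multiplies the dominating product, so the
    -- summation runs with `x` and `y` exchanged.
    ≤-trans (≈⇒≤ (+-comm _ _)) (abel (0≤x zero) x≤y Y≤X′ (≤-trans (≈⇒≤ (+-comm _ _)) X+Y≤))

-- Reflections and arcs of ℤ/m.

module _ {m : ℕ} .{{_ : NonZero m}} where

  infix 4 _≺_
  _≺_ : Fin m → Fin m → Set
  p ≺ q = _◁_ {m} (toℕ p) (toℕ q)

  infix 4 _≋_
  _≋_ : ℕ → ℕ → Set
  x ≋ y = x % m ≡ y % m

  ≋-+ : ∀ {x y u v} → x ≋ y → u ≋ v → x ℕ.+ u ≋ y ℕ.+ v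
  ≋-+ {x} {y} {u} {v} x≋y u≋v =
    trans (%-distribˡ-+ x u m) (trans (cong₂ (λ i j → (i ℕ.+ j) % m) x≋y u≋v)
      (sym (%-distribˡ-+ y v m)))

  -- The summand `c * pred m` acts as `-c`: it completes `c` to the multiple `c * m`.
  ≋-cancelˡ : ∀ c {x y} → c ℕ.+ x ≋ c ℕ.+ y → x ≋ y
  ≋-cancelˡ c {x} {y} cx≋cy = begin
    x % m                                     ≡⟨ complete x ⟨
    (c ℕ.* ℕ.pred m ℕ.+ (c ℕ.+ x)) % m        ≡⟨ ≋-+ {c ℕ.* ℕ.pred m} refl cx≋cy ⟩
    (c ℕ.* ℕ.pred m ℕ.+ (c ℕ.+ y)) % m        ≡⟨ complete y ⟩
    y % m                                     ∎
    where
    open ≡-Reasoning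
    complete : ∀ u → c ℕ.* ℕ.pred m ℕ.+ (c ℕ.+ u) ≋ u
    complete u = begin
      (c ℕ.* ℕ.pred m ℕ.+ (c ℕ.+ u)) % m      ≡⟨ cong (_% m) (ℕ.+-assoc _ c u) ⟨
      (c ℕ.* ℕ.pred m ℕ.+ c ℕ.+ u) % m        ≡⟨ cong (λ t → (t ℕ.+ u) % m)
                                                    (trans (ℕ.+-comm _ c) (sym (ℕ.*-suc c (ℕ.pred m)))) ⟩
      (c ℕ.* suc (ℕ.pred m) ℕ.+ u) % m        ≡⟨ cong (λ t → (c ℕ.* t ℕ.+ u) % m) (ℕ.suc-pred m) ⟩
      (c ℕ.* m ℕ.+ u) % m                     ≡⟨ cong (_% m) (ℕ.+-comm (c ℕ.* m) u) ⟩
      (u ℕ.+ c ℕ.* m) % m                     ≡⟨ [m+kn]%n≡m%n u c m ⟩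
      u % m                                   ∎

  toℕ-mod : ∀ n → toℕ (n mod m) ≋ n
  toℕ-mod n = trans (cong (_% m) (toℕ-fromℕ< (m%n<n n m))) (m%n%n≡m%n n m)

  ≋⇒≡ : ∀ {p q : Fin m} → toℕ p ≋ toℕ q → p ≡ q
  ≋⇒≡ {p} {q} p≋q = toℕ-injective
    (trans (sym (m<n⇒m%n≡m (toℕ<n p))) (trans p≋q (m<n⇒m%n≡m (toℕ<n q))))

  -- Two residues add up to less than `2m`, so at most one `m` has to be removed.
  +≋⇒mirrored : ∀ {s x y} → s ℕ.< m → x ℕ.< m → y ℕ.< m → x ℕ.+ y ≋ s → Mirrored {m} s x y
  +≋⇒mirrored {s} {x} {y} s<m x<m y<m eq with ℕ.<-≤-connex (x ℕ.+ y) m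
  ... | inj₁ x+y<m = inj₁ (trans (sym (m<n⇒m%n≡m x+y<m)) (trans eq (m<n⇒m%n≡m s<m)))
  ... | inj₂ m≤x+y with ℕ.m≤n⇒∃[o]m+o≡n m≤x+y
  ...   | d , m+d≡x+y = inj₂ (trans (sym m+d≡x+y) (trans (ℕ.+-comm m d) (cong (ℕ._+ m) d≡s)))
    where
    open ≡-Reasoning
    d<m : d ℕ.< m
    d<m = ℕ.+-cancelˡ-< m d m (subst (ℕ._< m ℕ.+ m) (sym m+d≡x+y) (ℕ.+-mono-< x<m y<m))
    d≡s : d ≡ s
    d≡s = begin
      d                   ≡⟨ m<n⇒m%n≡m d<m ⟨
      d % m               ≡⟨ [m+n]%n≡m%n d m ⟨
      (d ℕ.+ m) % m       ≡⟨ cong (_% m) (trans (ℕ.+-comm d m) m+d≡x+y) ⟩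
      (x ℕ.+ y) % m       ≡⟨ eq ⟩
      s % m               ≡⟨ m<n⇒m%n≡m s<m ⟩
      s                   ∎

  abstract
    -- The reflection `p ↦ s - p`. All its properties come from the congruence
    -- `toℕ p + toℕ (mirror s p) ≋ s`, which determines it.
    mirror : ℕ → Fin m → Fin m
    mirror s p = (s ℕ.+ (m ℕ.∸ toℕ p)) mod m

    mirror-sum : ∀ s p → toℕ p ℕ.+ toℕ (mirror s p) ≋ s
    mirror-sum s p = begin
      (toℕ p ℕ.+ toℕ (mirror s p)) % m            ≡⟨ ≋-+ {toℕ p} refl (toℕ-mod _) ⟩
      (toℕ p ℕ.+ (s ℕ.+ (m ℕ.∸ toℕ p))) % m       ≡⟨ cong (_% m) regroup ⟩
      (s ℕ.+ m) % m                               ≡⟨ [m+n]%n≡m%n s m ⟩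
      s % m                                       ∎
      where
      open ≡-Reasoning
      regroup : toℕ p ℕ.+ (s ℕ.+ (m ℕ.∸ toℕ p)) ≡ s ℕ.+ m
      regroup = begin
        toℕ p ℕ.+ (s ℕ.+ (m ℕ.∸ toℕ p))   ≡⟨ ℕ.+-comm (toℕ p) _ ⟩
        s ℕ.+ (m ℕ.∸ toℕ p) ℕ.+ toℕ p     ≡⟨ ℕ.+-assoc s _ _ ⟩
        s ℕ.+ (m ℕ.∸ toℕ p ℕ.+ toℕ p)     ≡⟨ cong (s ℕ.+_) (ℕ.m∸n+n≡m (ℕ.<⇒≤ (toℕ<n p))) ⟩
        s ℕ.+ m                           ∎

    mirror-unique : ∀ {s} p {q} → toℕ p ℕ.+ toℕ q ≋ s → mirror s p ≡ q
    mirror-unique {s} p p+q≋s = ≋⇒≡ (≋-cancelˡ (toℕ p) (trans (mirror-sum s p) (sym p+q≋s)))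

    mirror-involutive : ∀ s p → mirror s (mirror s p) ≡ p
    mirror-involutive s p = mirror-unique (mirror s p)
      (trans (cong (_% m) (ℕ.+-comm (toℕ (mirror s p)) (toℕ p))) (mirror-sum s p))

  shift : Fin m → ℕ → Fin m
  shift k j = (toℕ k ℕ.+ j) mod m

  -- The number of steps from `k` to `p`, that is `p - k`, is itself a reflection of `k`.
  offset : Fin m → Fin m → Fin m
  offset k p = mirror (toℕ p) k

  shift-offset : ∀ k p → shift k (toℕ (offset k p)) ≡ p
  shift-offset k p = ≋⇒≡ (trans (toℕ-mod _) (mirror-sum (toℕ p) k))

  offset-shift : ∀ k {j} → j ℕ.< m → toℕ (offset k (shift k j)) ≡ j
  offset-shift k {j} j<m = trans (cong toℕ (mirror-unique k {fromℕ< j<m} eq)) (toℕ-fromℕ< j<m)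
    where
    eq : toℕ k ℕ.+ toℕ (fromℕ< j<m) ≋ toℕ (shift k j)
    eq = trans (cong (λ t → (toℕ k ℕ.+ t) % m) (toℕ-fromℕ< j<m)) (sym (toℕ-mod _))

  -- A reflection reverses arcs, so the mirror image of an arc of `n + 1` points starts at the image
  -- of its last point `k + n`.
  arcMirror : ℕ → ℕ → Fin m → Fin m
  arcMirror s n k = mirror s (shift k n)

  arcMirror-sum : ∀ s n k → toℕ k ℕ.+ n ℕ.+ toℕ (arcMirror s n k) ≋ s
  arcMirror-sum s n k =
    trans (≋-+ (sym (toℕ-mod (toℕ k ℕ.+ n))) refl) (mirror-sum s (shift k n))

  arcMirror-involutive : ∀ s n k → arcMirror s n (arcMirror s n k) ≡ k
  arcMirror-involutive s n k = mirror-unique (shift k′ n) (begin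
    (toℕ (shift k′ n) ℕ.+ toℕ k) % m      ≡⟨ ≋-+ (toℕ-mod (toℕ k′ ℕ.+ n)) refl ⟩
    (toℕ k′ ℕ.+ n ℕ.+ toℕ k) % m          ≡⟨ cong (_% m) regroup ⟩
    (toℕ k ℕ.+ n ℕ.+ toℕ k′) % m          ≡⟨ arcMirror-sum s n k ⟩
    s % m                                 ∎)
    where
    open ≡-Reasoning
    k′ = arcMirror s n k
    regroup : toℕ k′ ℕ.+ n ℕ.+ toℕ k ≡ toℕ k ℕ.+ n ℕ.+ toℕ k′
    regroup = trans (ℕ.+-comm _ (toℕ k))
      (trans (cong (toℕ k ℕ.+_) (ℕ.+-comm (toℕ k′) n)) (sym (ℕ.+-assoc (toℕ k) n _)))

  -- `j` and `opposite j` add up to `n`, so the two positions add up to `s` by `arcMirror-sum`.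
  mirror-shift : ∀ s {n} k (j : Fin (suc n)) →
    mirror s (shift k (toℕ j)) ≡ shift (arcMirror s n k) (toℕ (opposite j))
  mirror-shift s {n} k j = mirror-unique (shift k j′) (begin
    (toℕ (shift k j′) ℕ.+ toℕ (shift k′ j″)) % m    ≡⟨ ≋-+ (toℕ-mod (toℕ k ℕ.+ j′)) (toℕ-mod _) ⟩
    (toℕ k ℕ.+ j′ ℕ.+ (toℕ k′ ℕ.+ j″)) % m          ≡⟨ cong (_% m) regroup ⟩
    (toℕ k ℕ.+ n ℕ.+ toℕ k′) % m                    ≡⟨ arcMirror-sum s n k ⟩
    s % m                                           ∎)
    where
    open ≡-Reasoning
    k′ = arcMirror s n k
    j′ j″ : ℕ
    j′ = toℕ j
    j″ = toℕ (opposite j)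
    j′+j″≡n : j′ ℕ.+ j″ ≡ n
    j′+j″≡n = trans (cong (j′ ℕ.+_) (opposite-prop j)) (ℕ.m+[n∸m]≡n (ℕ.≤-pred (toℕ<n j)))
    regroup : toℕ k ℕ.+ j′ ℕ.+ (toℕ k′ ℕ.+ j″) ≡ toℕ k ℕ.+ n ℕ.+ toℕ k′
    regroup = begin
      toℕ k ℕ.+ j′ ℕ.+ (toℕ k′ ℕ.+ j″)    ≡⟨ cong (toℕ k ℕ.+ j′ ℕ.+_) (ℕ.+-comm (toℕ k′) j″) ⟩
      toℕ k ℕ.+ j′ ℕ.+ (j″ ℕ.+ toℕ k′)    ≡⟨ ℕ.+-assoc (toℕ k ℕ.+ j′) j″ (toℕ k′) ⟨
      toℕ k ℕ.+ j′ ℕ.+ j″ ℕ.+ toℕ k′      ≡⟨ cong (ℕ._+ toℕ k′) (ℕ.+-assoc (toℕ k) j′ j″) ⟩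
      toℕ k ℕ.+ (j′ ℕ.+ j″) ℕ.+ toℕ k′    ≡⟨ cong (λ t → toℕ k ℕ.+ t ℕ.+ toℕ k′) j′+j″≡n ⟩
      toℕ k ℕ.+ n ℕ.+ toℕ k′              ∎

  OnArc : Fin m → ℕ → Fin m → Set
  OnArc k r p = toℕ (offset k p) ℕ.< r

  onArc? : ∀ k r p → Dec (OnArc k r p)
  onArc? k r p = toℕ (offset k p) ℕ.<? r

  module _ (k : Fin m) {r : ℕ} (r≤m : r ℕ.≤ m) where

    arc : Fin r → Fin m
    arc j = shift k (toℕ j)

    arc-onArc : ∀ j → OnArc k r (arc j)
    arc-onArc j = subst (ℕ._< r) (sym (offset-shift k (ℕ.<-≤-trans (toℕ<n j) r≤m))) (toℕ<n j)

    arc-fromℕ< : ∀ {p} (p∈ : OnArc k r p) → arc (fromℕ< p∈) ≡ p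
    arc-fromℕ< {p} p∈ = trans (cong (shift k) (toℕ-fromℕ< p∈)) (shift-offset k p)

    arc-injective : ∀ {i j} → arc i ≡ arc j → i ≡ j
    arc-injective {i} {j} eq = toℕ-injective (trans (sym (back i)) (trans (cong (toℕ ∘ offset k) eq) (back j)))
      where
      back : ∀ i → toℕ (offset k (arc i)) ≡ toℕ i
      back i = offset-shift k (ℕ.<-≤-trans (toℕ<n i) r≤m)

    module _ (φ : Fin m → Fin m) (φ-involutive : ∀ p → φ (φ p) ≡ p) where

      -- An involution φ permutes the points j of the arc for which φ (arc j) is
      -- again on the arc, so ∏ z (φ (arc j)) = ∏ z (fold j).
      fold : Fin r → Fin m
      fold j with onArc? k r (φ (arc j))
      ... | yes _ = arc j
      ... | no  _ = φ (arc j)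

      fold-on : ∀ {j} → OnArc k r (φ (arc j)) → fold j ≡ arc j
      fold-on {j} φj∈ with onArc? k r (φ (arc j))
      ... | yes _   = refl
      ... | no  φj∉ = contradiction φj∈ φj∉

      fold-off : ∀ {j} → ¬ OnArc k r (φ (arc j)) → fold j ≡ φ (arc j)
      fold-off {j} φj∉ with onArc? k r (φ (arc j))
      ... | yes φj∈ = contradiction φj∈ φj∉
      ... | no  _   = refl

      fold-index : Fin r → Fin r
      fold-index j with onArc? k r (φ (arc j))
      ... | yes φj∈ = fromℕ< φj∈
      ... | no  _   = j

      private
        φφ : ∀ {j} (φj∈ : OnArc k r (φ (arc j))) → φ (arc (fromℕ< φj∈)) ≡ arc j
        φφ {j} φj∈ = trans (cong φ (arc-fromℕ< φj∈)) (φ-involutive (arc j))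

      -- If `φ (arc j)` is on the arc, then `fold-index j` is its place there, and `φ` takes it back
      -- to `arc j`.
      φ-fold-index : ∀ j → φ (arc (fold-index j)) ≡ fold j
      φ-fold-index j with onArc? k r (φ (arc j))
      ... | yes φj∈ = φφ φj∈
      ... | no  _   = refl

      fold-index-involutive : ∀ j → fold-index (fold-index j) ≡ j
      fold-index-involutive j with onArc? k r (φ (arc j)) in eq
      ... | no _ rewrite eq = refl
      ... | yes φj∈ with onArc? k r (φ (arc (fromℕ< φj∈)))
      ...   | yes φφj∈ = arc-injective (trans (arc-fromℕ< φφj∈) (φφ φj∈))
      ...   | no  φφj∉ = contradiction (subst (OnArc k r) (sym (φφ φj∈)) (arc-onArc j)) φφj∉

      foldPermutation : Permutation′ r
      foldPermutation = permutation fold-index fold-index fold-index-involutive fold-index-involutive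

-- Polarization as an involution on positions.

module Polarization {m : ℕ} .{{_ : NonZero m}} {s : ℕ} (s<m : s ℕ.< m)
                    -- w p is the index of the number at position p.
                    (w : Fin m → Fin m) where

  ρ : Fin m → Fin m
  ρ = mirror s

  -- Numbers are compared by index, which is decidable; a smaller index means a number at least as
  -- large. Both orders of the pair occur, so `p` and `ρ p` decide alike.
  Inverted : Fin m → Fin m → Set
  Inverted p q = (p ≺ q × w q Fin.< w p) ⊎ (q ≺ p × w p Fin.< w q)

  inverted? : ∀ p q → Dec (Inverted p q)
  inverted? p q = ((toℕ p ◁? toℕ q) ×-dec w q Fin.<? w p) ⊎-dec
                  ((toℕ q ◁? toℕ p) ×-dec w p Fin.<? w q)

  abstract
    τ : Fin m → Fin m
    τ p with inverted? p (ρ p)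
    ... | yes _ = ρ p
    ... | no  _ = p

    τ-inverted : ∀ {p} → Inverted p (ρ p) → τ p ≡ ρ p
    τ-inverted {p} inv with inverted? p (ρ p)
    ... | yes _    = refl
    ... | no  ¬inv = contradiction inv ¬inv

    τ-ordered : ∀ {p} → ¬ Inverted p (ρ p) → τ p ≡ p
    τ-ordered {p} ¬inv with inverted? p (ρ p)
    ... | yes inv = contradiction inv ¬inv
    ... | no  _   = refl

  τ-cases : ∀ p → (Inverted p (ρ p) × τ p ≡ ρ p × τ (ρ p) ≡ p) ⊎
                  (¬ Inverted p (ρ p) × τ p ≡ p × τ (ρ p) ≡ ρ p)
  τ-cases p with inverted? p (ρ p)
  ... | yes inv = inj₁ (inv , τ-inverted inv ,
    trans (τ-inverted (subst (Inverted (ρ p)) (sym (mirror-involutive s p)) (Sum.swap inv)))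
          (mirror-involutive s p))
  ... | no ¬inv = inj₂ (¬inv , τ-ordered ¬inv ,
    τ-ordered λ inv → ¬inv (Sum.swap (subst (Inverted (ρ p)) (mirror-involutive s p) inv)))

  τ-involutive : ∀ p → τ (τ p) ≡ p
  τ-involutive p with τ-cases p
  ... | inj₁ (_ , τp , τρp) = trans (cong τ τp) τρp
  ... | inj₂ (_ , τp , _)   = trans (cong τ τp) τp

  -- `fold` requires an involution, and it is applied to `τ ∘ ρ` as well as to `ρ` and `τ`.
  τρ-involutive : ∀ p → τ (ρ (τ (ρ p))) ≡ p
  τρ-involutive p with τ-cases p
  ... | inj₁ (_ , τp , τρp) = trans (cong (τ ∘ ρ) τρp) τρp
  ... | inj₂ (_ , τp , τρp) = trans (cong (τ ∘ ρ) τρp) (trans (cong τ (mirror-involutive s p)) τp)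

  module _ (k : Fin m) {r : ℕ} (r≤m : r ℕ.≤ m) where

    private
      pt : Fin r → Fin m
      pt = arc k r≤m

    Paired : Fin r → Set
    Paired j = OnArc k r (ρ (pt j))

    -- `φ` stands for `ρ`, `τ` or `τ ∘ ρ`, each of which either fixes a point or reflects it. If
    -- both points of the pair are on the arc, folding leaves the same point in every product, hence
    -- a common factor.
    fold-paired : ∀ φ φ² {j} → φ (pt j) ≡ pt j ⊎ φ (pt j) ≡ ρ (pt j) → Paired j →
                  fold k r≤m φ φ² j ≡ pt j
    fold-paired φ φ² {j} (inj₁ φj≡) _  =
      fold-on k r≤m φ φ² (subst (OnArc k r) (sym φj≡) (arc-onArc k r≤m j))
    fold-paired φ φ² {j} (inj₂ φj≡) j∈ = fold-on k r≤m φ φ² (subst (OnArc k r) (sym φj≡) j∈)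

    fold-unpaired : ∀ φ φ² {j} → φ (pt j) ≡ pt j ⊎ φ (pt j) ≡ ρ (pt j) → ¬ Paired j →
                    fold k r≤m φ φ² j ≡ φ (pt j)
    fold-unpaired φ φ² {j} (inj₁ φj≡) _  =
      trans (fold-on k r≤m φ φ² (subst (OnArc k r) (sym φj≡) (arc-onArc k r≤m j))) (sym φj≡)
    fold-unpaired φ φ² {j} (inj₂ φj≡) j∉ = fold-off k r≤m φ φ² (j∉ ∘ subst (OnArc k r) φj≡)

    τ-choice : ∀ p → τ p ≡ p ⊎ τ p ≡ ρ p
    τ-choice p = Sum.swap (Sum.map (proj₁ ∘ proj₂) (proj₁ ∘ proj₂) (τ-cases p))

    τρ-choice : ∀ p → τ (ρ p) ≡ p ⊎ τ (ρ p) ≡ ρ p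
    τρ-choice p = Sum.map (proj₂ ∘ proj₂) (proj₂ ∘ proj₂) (τ-cases p)

    -- Offsets from `k` serve as the displacements in `arc-one-sided`: below `r` on the arc, at
    -- least `r` off it.
    unpaired-one-sided : ∀ {i j} → ¬ Paired i → ¬ Paired j → pt i ≺ ρ (pt i) → ¬ ρ (pt j) ≺ pt j
    unpaired-one-sided {i} {j} i∉ j∉ = arc-one-sided (toℕ<n k) r≤m s<m
      (toℕ<n (pt i)) (toℕ<n (ρ (pt i))) (toℕ<n (pt j)) (toℕ<n (ρ (pt j)))
      (toℕ<n i) (on i) (toℕ<n j) (on j)
      (ℕ.≮⇒≥ i∉) (toℕ<n (offset k (ρ (pt i)))) (at (ρ (pt i)))
      (ℕ.≮⇒≥ j∉) (toℕ<n (offset k (ρ (pt j)))) (at (ρ (pt j)))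
      (mir i) (mir j)
      where
      on : ∀ i → Mirrored {m} (toℕ (pt i)) (toℕ k) (toℕ i)
      on i = +≋⇒mirrored (toℕ<n (pt i)) (toℕ<n k) (ℕ.<-≤-trans (toℕ<n i) r≤m) (sym (toℕ-mod _))
      at : ∀ p → Mirrored {m} (toℕ p) (toℕ k) (toℕ (offset k p))
      at p = +≋⇒mirrored (toℕ<n p) (toℕ<n k) (toℕ<n (offset k p)) (mirror-sum (toℕ p) k)
      mir : ∀ i → Mirrored {m} s (toℕ (pt i)) (toℕ (ρ (pt i)))
      mir i = +≋⇒mirrored s<m (toℕ<n (pt i)) (toℕ<n (ρ (pt i))) (mirror-sum s (pt i))

    -- A fixed point of `ρ` on the arc is paired with itself, so an unpaired point differs from its
    -- image and the two are comparable.
    unpaired-side : ∀ {j} → ¬ Paired j → pt j ≺ ρ (pt j) ⊎ ρ (pt j) ≺ pt j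
    unpaired-side {j} j∉ with nearer-total {m} {toℕ (pt j)} {toℕ (ρ (pt j))}
      (λ eq → j∉ (subst (OnArc k r) (toℕ-injective eq) (arc-onArc k r≤m j)))
    ... | inj₁ near = inj₁ (nearer⇒◁ (toℕ<n (pt j)) (toℕ<n (ρ (pt j))) near)
    ... | inj₂ far  = inj₂ (nearer⇒◁ (toℕ<n (ρ (pt j))) (toℕ<n (pt j)) far)

-- Effect of one polarization on `P`.

module _ {c ℓ₁ ℓ₂} (ℝ : RealNumbers c ℓ₁ ℓ₂) {m : ℕ} .{{_ : NonZero m}} where
  private
    module R = RealNumbers ℝ
  open RealNumbers ℝ using (Carrier; _≈_; _≤_; 0#; _+_; sum; product)
  open OrderedField ℝ
  open import Relation.Binary.Reasoning.Preorder ≤-preorder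

  P-cong : ∀ {z z′ : Fin m → Carrier} r → (∀ i → z i ≈ z′ i) → P ℝ r z ≈ P ℝ r z′
  P-cong r z≈z′ = Σ.sum-cong-≋ λ k → Π.sum-cong-≋ {r} λ j → z≈z′ (shift k (toℕ j))

  -- Reflection permutes the starting points of the arcs and reverses the factors within each. The
  -- permutation involves `r - 1`, so `r = 0` is treated apart.
  P-mirror : ∀ s r (z : Fin m → Carrier) →
    P ℝ r z ≈ sum {m} λ k → product {r} λ j → z (mirror s (shift k (toℕ j)))
  P-mirror s zero    z = R.refl
  P-mirror s (suc n) z = begin-equality
    sum {m} (λ k → arcProduct k)                                             ≈⟨ Σ.sum-permute arcProduct π ⟩
    sum {m} (λ k → arcProduct (arcMirror s n k))                             ≈⟨ Σ.sum-cong-≋ {m} reversed ⟩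
    sum {m} (λ k → product {suc n} λ j → z (mirror s (shift k (toℕ j))))     ∎
    where
    arcProduct : Fin m → Carrier
    arcProduct k = product {suc n} λ j → z (shift k (toℕ j))
    π : Permutation′ m
    π = permutation (arcMirror s n) (arcMirror s n) (arcMirror-involutive s n) (arcMirror-involutive s n)
    reversed : ∀ k → arcProduct (arcMirror s n k) ≈ product {suc n} λ j → z (mirror s (shift k (toℕ j)))
    reversed k = R.trans
      (Π.sum-permute (λ j → z (shift (arcMirror s n k) (toℕ j))) (reverse {suc n}))
      (Π.sum-cong-≋ {suc n} λ j → R.reflexive (cong z (sym (mirror-shift s k j))))

  module _ (a : Fin m → Carrier) (a-mono : ∀ {i j} → i Fin.≤ j → a j ≤ a i) (0≤a : ∀ i → 0# ≤ a i) where

    module _ {s : ℕ} (s<m : s ℕ.< m) (w : Fin m → Fin m) where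
      open Polarization s<m w

      private
        z : Fin m → Carrier
        z = a ∘ w

      -- The index comparison made by `τ` yields the inequality between the real numbers, by
      -- monotonicity of `a`.
      polarized-sorts : ∀ p → p ≺ ρ p → Sorts (z p) (z (ρ p)) (z (τ p)) (z (τ (ρ p)))
      polarized-sorts p p≺ρp with τ-cases p
      ... | inj₁ (inj₁ (_ , wρp<wp) , τp , τρp) rewrite τp | τρp = swap (a-mono (ℕ.<⇒≤ wρp<wp))
      ... | inj₁ (inj₂ (ρp≺p , _) , _) = contradiction ρp≺p (◁-asym p≺ρp)
      ... | inj₂ (¬inv , τp , τρp) rewrite τp | τρp =
        keep (a-mono (ℕ.≮⇒≥ λ wρp<wp → ¬inv (inj₁ (p≺ρp , wρp<wp))))

      polarized-sorts′ : ∀ p → ρ p ≺ p → Sorts (z (ρ p)) (z p) (z (τ (ρ p))) (z (τ p))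
      polarized-sorts′ p ρp≺p = subst (λ q → Sorts (z (ρ p)) (z q) (z (τ (ρ p))) (z (τ q)))
        (mirror-involutive s p)
        (polarized-sorts (ρ p) (subst (λ q → ρ p ≺ q) (sym (mirror-involutive s p)) ρp≺p))

      module _ {r : ℕ} (r≤m : r ℕ.≤ m) where

        private
          product-fold : ∀ k φ φ² →
            product {r} (λ j → z (φ (arc k r≤m j))) ≈ product {r} (λ j → z (fold k r≤m φ φ² j))
          product-fold k φ φ² = R.trans
            (Π.sum-permute (λ j → z (φ (arc k r≤m j))) (foldPermutation k r≤m φ φ²))
            (Π.sum-cong-≋ {r} λ j → R.reflexive (cong z (φ-fold-index k r≤m φ φ² j)))

        -- Folding leaves in slot `j` either a common factor or a mirror pair with its polarized
        -- version, the form that `sorted-products` needs.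
        arcs-≤ : ∀ k →
          product {r} (λ j → z (shift k (toℕ j))) + product {r} (λ j → z (ρ (shift k (toℕ j)))) ≤
          product {r} (λ j → z (τ (shift k (toℕ j)))) + product {r} (λ j → z (τ (ρ (shift k (toℕ j)))))
        arcs-≤ k = begin
          product {r} (λ j → z (pt j)) + product {r} (λ j → z (ρ (pt j)))
            ≈⟨ R.+-congˡ (product-fold k ρ (mirror-involutive s)) ⟩
          product {r} x + product {r} y
            ≲⟨ folded-≤ ⟩
          product {r} x′ + product {r} y′
            ≈⟨ R.+-cong (product-fold k τ τ-involutive) (product-fold k (τ ∘ ρ) τρ-involutive) ⟨
          product {r} (λ j → z (τ (pt j))) + product {r} (λ j → z (τ (ρ (pt j))))
            ∎
          where
          pt : Fin r → Fin m
          pt = arc k r≤m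
          x y x′ y′ : Fin r → Carrier
          x j  = z (pt j)
          y j  = z (fold k r≤m ρ (mirror-involutive s) j)
          x′ j = z (fold k r≤m τ τ-involutive j)
          y′ j = z (fold k r≤m (τ ∘ ρ) τρ-involutive j)
          -- `S` is general so that it can be `Sorts` or `Sorts` with the two products exchanged,
          -- according to the side of the axis.
          folded : ∀ {ℓ} (S : Carrier → Carrier → Carrier → Carrier → Set ℓ) → (∀ u → S u u u u) →
            (∀ {j} → ¬ Paired k r≤m j → S (z (pt j)) (z (ρ (pt j))) (z (τ (pt j))) (z (τ (ρ (pt j))))) →
            ∀ j → S (x j) (y j) (x′ j) (y′ j)
          folded S S-refl unpaired j = [ paired-case , unpaired-case ]′ (toSum (onArc? k r (ρ (pt j))))
            where
            S-resp : ∀ {o p q v p′ q′ v′} → p ≡ p′ → q ≡ q′ → v ≡ v′ →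
                     S (z o) (z p′) (z q′) (z v′) → S (z o) (z p) (z q) (z v)
            S-resp refl refl refl S′ = S′
            paired-case : Paired k r≤m j → S (x j) (y j) (x′ j) (y′ j)
            paired-case j∈ = S-resp
              (fold-paired k r≤m ρ (mirror-involutive s) (inj₂ refl) j∈)
              (fold-paired k r≤m τ τ-involutive (τ-choice k r≤m (pt j)) j∈)
              (fold-paired k r≤m (τ ∘ ρ) τρ-involutive (τρ-choice k r≤m (pt j)) j∈)
              (S-refl (z (pt j)))
            unpaired-case : ¬ Paired k r≤m j → S (x j) (y j) (x′ j) (y′ j)
            unpaired-case j∉ = S-resp
              (fold-unpaired k r≤m ρ (mirror-involutive s) (inj₂ refl) j∉)
              (fold-unpaired k r≤m τ τ-involutive (τ-choice k r≤m (pt j)) j∉)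
              (fold-unpaired k r≤m (τ ∘ ρ) τρ-involutive (τρ-choice k r≤m (pt j)) j∉)
              (unpaired j∉)
          folded-≤ : product {r} x + product {r} y ≤ product {r} x′ + product {r} y′
          -- One unpaired point farther than its image forces all unpaired points to be so, and then
          -- the mirrored product collects the larger factors. If there is none, all are nearer and
          -- the arc itself collects them.
          folded-≤ with any? (λ j → ¬? (onArc? k r (ρ (pt j))) ×-dec (toℕ (ρ (pt j)) ◁? toℕ (pt j)))
          ... | yes (i , i∉ , ρi≺i) = begin
            product {r} x + product {r} y     ≈⟨ R.+-comm _ _ ⟩
            product {r} y + product {r} x     ≲⟨ proj₂ (proj₂ (proj₂ (sorted-products (λ _ → 0≤a _) (λ _ → 0≤a _) sorts))) ⟩
            product {r} y′ + product {r} x′   ≈⟨ R.+-comm _ _ ⟩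
            product {r} x′ + product {r} y′   ∎
            where
            far : ∀ {j} → ¬ Paired k r≤m j → ρ (pt j) ≺ pt j
            far {j} j∉ with unpaired-side k r≤m j∉
            ... | inj₁ j≺ρj = contradiction ρi≺i (unpaired-one-sided k r≤m j∉ i∉ j≺ρj)
            ... | inj₂ ρj≺j = ρj≺j
            sorts : ∀ j → Sorts (y j) (x j) (y′ j) (x′ j)
            sorts = folded (λ u v u′ v′ → Sorts v u v′ u′) (λ _ → keep (≈⇒≤ R.refl))
              (λ {j} j∉ → polarized-sorts′ (pt j) (far j∉))
          ... | no ∄far = proj₂ (proj₂ (proj₂ (sorted-products (λ _ → 0≤a _) (λ _ → 0≤a _) sorts)))
            where
            near : ∀ {j} → ¬ Paired k r≤m j → pt j ≺ ρ (pt j)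
            near {j} j∉ with unpaired-side k r≤m j∉
            ... | inj₁ j≺ρj = j≺ρj
            ... | inj₂ ρj≺j = contradiction (j , j∉ , ρj≺j) ∄far
            sorts : ∀ j → Sorts (x j) (y j) (x′ j) (y′ j)
            sorts = folded Sorts (λ _ → keep (≈⇒≤ R.refl)) (λ {j} j∉ → polarized-sorts (pt j) (near j∉))

        -- `P` is counted once over arcs and once over their mirror images, so the arcwise
        -- inequalities add up to twice the claim.
        polarize-≤ : P ℝ r z ≤ P ℝ r (z ∘ τ)
        polarize-≤ = x+x≤y+y⇒x≤y (begin
          P ℝ r z + P ℝ r z                              ≈⟨ double z ⟩
          sum {m} (λ k → both z k)                       ≲⟨ sum-mono-≤ arcs-≤ ⟩
          sum {m} (λ k → both (z ∘ τ) k)                 ≈⟨ double (z ∘ τ) ⟨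
          P ℝ r (z ∘ τ) + P ℝ r (z ∘ τ)                  ∎)
          where
          forward backward both : (Fin m → Carrier) → Fin m → Carrier
          forward  u k = product {r} λ j → u (shift k (toℕ j))
          backward u k = product {r} λ j → u (ρ (shift k (toℕ j)))
          both u k = forward u k + backward u k
          double : ∀ u → P ℝ r u + P ℝ r u ≈ sum {m} (both u)
          double u = R.trans (R.+-congˡ (P-mirror s r u)) (R.sym (Σ.∑-distrib-+ (forward u) (backward u)))

-- Moving the next number to its greedy place.

module _ {m : ℕ} .{{_ : NonZero m}} where

  greedyIndex-surjective : ∀ {n} → n ℕ.< m → ∃ λ (p : Fin m) → greedyIndex m (toℕ p) ≡ n
  greedyIndex-surjective {n} n<m with injective⇒surjective rank rank-injective (fromℕ< n<m)
    where
    rank : Fin m → Fin m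
    rank p = fromℕ< (greedyIndex<m (toℕ<n p))
    rank-injective : Injective _≡_ _≡_ rank
    rank-injective {p} {q} eq = toℕ-injective (greedyIndex-injective (toℕ<n p) (toℕ<n q)
      (trans (sym (toℕ-fromℕ< _)) (trans (cong toℕ eq) (toℕ-fromℕ< _))))
  ... | p , eq = p , trans (sym (toℕ-fromℕ< _)) (trans (cong toℕ eq) (toℕ-fromℕ< n<m))

  -- The invariant of the iteration; for `n = m` it makes `a ∘ w` the greedy arrangement.
  GreedyBelow : ℕ → (Fin m → Fin m) → Set
  GreedyBelow n w = ∀ p → greedyIndex m (toℕ p) ℕ.< n → toℕ (w p) ≡ greedyIndex m (toℕ p)

  -- The greedy place of the number already holds it, and `w` is injective.
  greedyBelow-value : ∀ {n w} → n ℕ.≤ m → Injective _≡_ _≡_ w → GreedyBelow n w →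
    ∀ p → toℕ (w p) ℕ.< n → toℕ (w p) ≡ greedyIndex m (toℕ p)
  greedyBelow-value {n} {w} n≤m w-inj below p wp<n with greedyIndex-surjective (ℕ.<-≤-trans wp<n n≤m)
  ... | q , q≡wp with w-inj {q} {p} (toℕ-injective (trans (below q (subst (ℕ._< n) (sym q≡wp) wp<n)) q≡wp))
  ...   | refl = sym q≡wp

  module _ {n : ℕ} (n<m : n ℕ.< m)
           {w : Fin m → Fin m} (w-inj : Injective _≡_ _≡_ w) (below : GreedyBelow n w)
           {g q : Fin m} (g≡n : greedyIndex m (toℕ g) ≡ n) (wq≡n : toℕ (w q) ≡ n) (g≢q : g ≢ q) where

    -- The sum `g + q` gives the reflection exchanging `g`, the greedy place of number `n`, with
    -- `q`, its current position.
    open Polarization {m} {(toℕ g ℕ.+ toℕ q) % m} (m%n<n _ m) w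

    private
      value : ∀ p → toℕ (w p) ℕ.< n → toℕ (w p) ≡ greedyIndex m (toℕ p)
      value = greedyBelow-value (ℕ.<⇒≤ n<m) w-inj below

      index-injective : ∀ {p p′ : Fin m} → greedyIndex m (toℕ p) ≡ greedyIndex m (toℕ p′) → p ≡ p′
      index-injective {p} {p′} eq = toℕ-injective (greedyIndex-injective (toℕ<n p) (toℕ<n p′) eq)

      -- Places of index below `n` hold their own numbers, so `q`, which holds number `n`, is not
      -- among them.
      g≺q : g ≺ q
      g≺q = ◁-by (ℕ.≤∧≢⇒< (subst (ℕ._≤ _) (sym g≡n) n≤q) (g≢q ∘ index-injective))
        where
        n≤q : n ℕ.≤ greedyIndex m (toℕ q)
        n≤q = ℕ.≮⇒≥ λ q<n → ℕ.<-irrefl (trans (sym (below q q<n)) wq≡n) q<n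

      -- Numbers below `n` sit at their own places, and `g` is not one of these. Together with `g≺q`
      -- this makes the pair inverted.
      wq<wg : w q Fin.< w g
      wq<wg = ℕ.≤∧≢⇒< (subst (ℕ._≤ _) (sym wq≡n) n≤wg) (λ eq → g≢q (sym (w-inj (toℕ-injective eq))))
        where
        n≤wg : n ℕ.≤ toℕ (w g)
        n≤wg = ℕ.≮⇒≥ λ wg<n → ℕ.<-irrefl (trans (value g wg<n) g≡n) wg<n

      ρg≡q : ρ g ≡ q
      ρg≡q = mirror-unique g (sym (m%n%n≡m%n (toℕ g ℕ.+ toℕ q) m))

      τg≡q : τ g ≡ q
      τg≡q = trans (τ-inverted (subst (Inverted g) (sym ρg≡q) (inj₁ (g≺q , wq<wg)))) ρg≡q

      -- In an inversion the partner of `p` would also be settled, by its smaller number or its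
      -- smaller index. At settled positions number and index agree, so their orders cannot be
      -- opposite.
      τ-below : ∀ p → greedyIndex m (toℕ p) ℕ.< n → ¬ Inverted p (ρ p)
      τ-below p p<n (inj₁ (p≺ρp , wρp<wp)) = ℕ.<-asym (greedyIndex-< p≺ρp)
        (subst₂ ℕ._<_ (value (ρ p) (ℕ.<-trans wρp<wp (subst (ℕ._< n) (sym (below p p<n)) p<n)))
                      (below p p<n) wρp<wp)
      τ-below p p<n (inj₂ (ρp≺p , wp<wρp)) = ℕ.<-asym (greedyIndex-< ρp≺p)
        (subst₂ ℕ._<_ (below p p<n) (below (ρ p) (ℕ.<-trans (greedyIndex-< ρp≺p) p<n)) wp<wρp)

    polarize-greedyBelow : GreedyBelow (suc n) (w ∘ τ)
    polarize-greedyBelow p p<1+n with ℕ.m≤n⇒m<n∨m≡n (ℕ.≤-pred p<1+n)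
    ... | inj₁ p<n = trans (cong (toℕ ∘ w) (τ-ordered (τ-below p p<n))) (below p p<n)
    ... | inj₂ p≡n with index-injective {p} {g} (trans p≡n (sym g≡n))
    ...   | refl = trans (cong (toℕ ∘ w) τg≡q) (trans wq≡n (sym p≡n))

  τ-injective : ∀ {s} (s<m : s ℕ.< m) w → Injective _≡_ _≡_ (Polarization.τ s<m w)
  τ-injective s<m w {p} {q} eq = trans (sym (τ-involutive p)) (trans (cong τ eq) (τ-involutive q))
    where open Polarization s<m w

-- Iteration and the maximality of the greedy arrangement.

module _ {c ℓ₁ ℓ₂} (ℝ : RealNumbers c ℓ₁ ℓ₂) {m : ℕ} .{{_ : NonZero m}} where
  open RealNumbers ℝ using (Carrier; _≈_; _≤_; 0#)
  open OrderedField ℝ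

  module _ {a : Fin m → Carrier} (a-mono : ∀ {i j} → i Fin.≤ j → a j ≤ a i) (0≤a : ∀ i → 0# ≤ a i)
           {r : ℕ} (r≤m : r ℕ.≤ m) {w : Fin m → Fin m} (w-inj : Injective _≡_ _≡_ w) where

    -- Injectivity is carried along because it locates the number `n` in `w′`.
    polarize-to-greedyBelow : ∀ n → n ℕ.≤ m →
      ∃ λ w′ → Injective _≡_ _≡_ w′ × GreedyBelow n w′ × P ℝ r (a ∘ w) ≤ P ℝ r (a ∘ w′)
    polarize-to-greedyBelow zero    _   = w , w-inj , (λ _ ()) , ≈⇒≤ (RealNumbers.refl ℝ)
    polarize-to-greedyBelow (suc n) n<m
      with polarize-to-greedyBelow n (ℕ.<⇒≤ n<m)
    ... | w′ , w′-inj , below , Pw≤Pw′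
      with greedyIndex-surjective n<m | injective⇒surjective w′ w′-inj (fromℕ< n<m)
    ...   | g , g≡n | q , w′q≡n with g Fin.≟ q
    ...     | yes refl = w′ , w′-inj , below′ , Pw≤Pw′
      where
      below′ : GreedyBelow (suc n) w′
      below′ p p<1+n with ℕ.m≤n⇒m<n∨m≡n (ℕ.≤-pred p<1+n)
      ... | inj₁ p<n = below p p<n
      ... | inj₂ p≡n with toℕ-injective (greedyIndex-injective (toℕ<n p) (toℕ<n g) (trans p≡n (sym g≡n)))
      ...   | refl = trans (cong toℕ w′q≡n) (trans (toℕ-fromℕ< n<m) (sym p≡n))
    ...     | no g≢q = w′ ∘ τ , (λ eq → τ-injective s<m w′ (w′-inj eq)) ,
      polarize-greedyBelow n<m w′-inj below g≡n (trans (cong toℕ w′q≡n) (toℕ-fromℕ< n<m)) g≢q ,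
      ≤-trans Pw≤Pw′ (polarize-≤ ℝ a a-mono 0≤a s<m w′ r≤m)
      where
      s<m : (toℕ g ℕ.+ toℕ q) % m ℕ.< m
      s<m = m%n<n _ m
      open Polarization s<m w′ using (τ)

    -- With all `m` numbers settled, `w′ p` is the greedy index of `p`; the two are compared modulo
    -- `m` because `greedy` reduces its index.
    greedy-maximal : P ℝ r (a ∘ w) ≤ P ℝ r (greedy a)
    greedy-maximal with polarize-to-greedyBelow m ℕ.≤-refl
    ... | w′ , _ , below , Pw≤Pw′ = ≤-trans Pw≤Pw′ (≈⇒≤ (P-cong ℝ r λ p →
      RealNumbers.reflexive ℝ (cong a (≋⇒≡ (trans (cong (_% m) (below p (greedyIndex<m (toℕ<n p))))
        (sym (toℕ-mod (greedyIndex m (toℕ p)))))))))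

theorem1p1 : ∀ {c ℓ₁ ℓ₂} (ℝ : RealNumbers c ℓ₁ ℓ₂) →
    let open RealNumbers ℝ in
    (m : ℕ) .{{_ : NonZero m}} → 2 ℕ.≤ m →
    (a : Fin m → Carrier) →
    (∀ {i j} → i Fin.≤ j → a j ≤ a i) →
    0# < a ((m ℕ.∸ 1) mod m) →
    (r : ℕ) → 1 ℕ.≤ r → r ℕ.≤ m →
    (z : Fin m → Carrier) → IsArrangement ℝ a z →
    P ℝ r z ≤ P ℝ r (greedy a)
theorem1p1 ℝ m _ a a-mono 0<a-last r _ r≤m z (σ , z≈aσ) =
  ≤-trans (≈⇒≤ (P-cong ℝ r z≈aσ)) (greedy-maximal ℝ a-mono 0≤a r≤m (Injection.injective (↔⇒↣ σ)))
  where
  open RealNumbers ℝ using (_≤_; 0#; isStrictPartialOrder)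
  open OrderedField ℝ using (≤-trans; ≈⇒≤)
  last-max : ∀ (i : Fin m) → i Fin.≤ ((m ℕ.∸ 1) mod m)
  last-max i = subst (toℕ i ℕ.≤_) (sym toℕ-last)
    (ℕ.≤-pred (subst (toℕ i ℕ.<_) (sym (ℕ.suc-pred m)) (toℕ<n i)))
    where
    toℕ-last : toℕ ((m ℕ.∸ 1) mod m) ≡ m ℕ.∸ 1
    toℕ-last = trans (toℕ-fromℕ< _) (m<n⇒m%n≡m (subst (m ℕ.∸ 1 ℕ.<_) (ℕ.suc-pred m) ℕ.≤-refl))
  0≤a : ∀ i → 0# ≤ a i
  -- A negative `a i` would lie below the positive last entry, against monotonicity.
  0≤a i ai<0 = a-mono (last-max i) (IsStrictPartialOrder.trans isStrictPartialOrder ai<0 0<a-last)
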